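{- Let $D$ be an odd spoof perfect number, written as $D=pq$ with $q\in\mathcal{S}$ and $p$ its pseudo-prime factor; that is, $q$ is an odd positive integer, $p>1$ is an odd integer that is not prime, and $$\frac{2q}{\sigma(q)}-1=\frac1p .$$ If $D\neq 198585576189$, then $q>10^{12}$.
   Context: $\sigma(n)$ denotes the sum of all positive divisors of the positive integer $n$. $\mathcal{S}$ denotes the set of odd positive integers $n$ such that $\frac{2n}{\sigma(n)}-1=\frac1x$ for some positive integer $x$ (this $x$ is uniquely determined by $n$). If $n\in\mathcal{S}$ and the corresponding integer $x>1$ is odd but not prime, the number $D=nx$ is called an odd spoof perfect number (it would be perfect if only $x$ were prime), and $x$ is called its pseudo-prime factor. The only currently known example, due to Descartes, is $D=198585576189$, with $n=9018009$ and $x=22021$. -}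

module Defs where

open import Data.Integer.Base using (+_)
open import Data.List.Base using (List; _∷_; applyUpTo; filter)
open import Data.List.Membership.Propositional using (_∈_)
open import Data.List.Membership.Propositional.Properties using (∈-applyUpTo⁺; ∈-filter⁺)
open import Data.List.Relation.Unary.Any using (here; there)
open import Data.Nat.Base using (ℕ; suc; NonZero; _*_; _≤_; _>_; z≤n; s≤s; >-nonZero)
open import Data.Nat.Divisibility using (_∣_; _∣?_; ∣-refl)
open import Data.Nat.ListAction using (sum)
open import Data.Nat.Primality using (Prime)
open import Data.Nat.Properties using (≤-trans; m≤m+n; m≤n+m; n<1+n)
open import Data.Product.Base using (∃-syntax)
open import Data.Rational.Base using (_/_; _-_; 1ℚ)
open import Relation.Binary.PropositionalEquality using (_≡_; refl)
open import Relation.Nullary.Negation using (¬_)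

Odd : ℕ → Set
Odd n = ¬ 2 ∣ n

divisors : ℕ → List ℕ
divisors n = filter (_∣? n) (applyUpTo suc n)

σ : ℕ → ℕ
σ n = sum (divisors n)

∈⇒≤sum : ∀ {m ns} → m ∈ ns → m ≤ sum ns
∈⇒≤sum {ns = n ∷ ns} (here refl)  = m≤m+n n (sum ns)
∈⇒≤sum {ns = n ∷ ns} (there m∈ns) = ≤-trans (∈⇒≤sum m∈ns) (m≤n+m (sum ns) n)

σ-nonZero : ∀ n → .{{NonZero n}} → NonZero (σ n)
σ-nonZero (suc k) = >-nonZero (≤-trans (s≤s z≤n)
  (∈⇒≤sum (∈-filter⁺ (_∣? suc k) (∈-applyUpTo⁺ suc (n<1+n k)) ∣-refl)))

record CorrespondsTo (n x : ℕ) : Set where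
  field
    {{n-nonZero}} : NonZero n
    {{x-nonZero}} : NonZero x
    n-odd         : Odd n
    equation      : _/_ (+ (2 * n)) (σ n) {{σ-nonZero n}} - 1ℚ ≡ + 1 / x

𝒮 : ℕ → Set
𝒮 n = ∃[ x ] CorrespondsTo n x

-- The components n ∈ 𝒮 and x (the pseudo-prime factor) are indices, so the
-- predicate "D is an odd spoof perfect number" is ∃[ n ] ∃[ x ] IsOddSpoof D n x.
record IsOddSpoof (D n x : ℕ) : Set where
  field
    D≡n*x       : D ≡ n * x
    corresponds : CorrespondsTo n x
    x>1         : x > 1
    x-odd       : Odd x
    x-notPrime  : ¬ Prime x

{-# OPTIONS --safe #-}

-- With X = σ(q) the defining equation reads X (p + 1) = 2 p q, so X = p d for the deficiency
-- d = 2 q − X, and q determines p.  As p and q are odd, so is σ(q), hence every prime exponent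
-- of q is even; as p is odd, composite and > 1, p ≥ 9, hence 9 q ≤ 5 σ(q).  A depth-first search
-- over the least prime factor l of the unexplored cofactor n of q = K n therefore only visits
-- even exponents, and discards K once 2 K < σ(K), or once 5 σ(K) σ(n) < 9 K n for every possible
-- n, using σ(r^a) / r^a < l / (l − 1) for each prime r ≥ l; about 275 000 nodes remain for
-- q ≤ 10¹².
module Submission where

open import Defs
open import Data.Bool.Base using (Bool; true; false; T; not; _∧_; _∨_; if_then_else_)
open import Data.Bool.Properties using (T-∧; T-∨; T-≡)
import Data.Integer.Base as ℤ
import Data.Integer.Properties as ℤ
open import Data.List.Base using ([]; _∷_; _++_; map; applyUpTo)
open import Data.List.Membership.Propositional using (_∈_)
open import Data.List.Membership.Propositional.Properties
  using (∈-applyUpTo⁺; ∈-filter⁺; ∈-filter⁻; ∈-map⁺; ∈-map⁻; ∈-++⁺ˡ; ∈-++⁺ʳ; ∈-++⁻)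
open import Data.List.Membership.Propositional.Properties.WithK using (unique∧set⇒bag)
open import Data.List.Relation.Binary.BagAndSetEquality using (∼bag⇒↭)
open import Data.List.Relation.Binary.Permutation.Propositional using (_↭_)
open import Data.List.Relation.Unary.Unique.Propositional using (Unique)
import Data.List.Relation.Unary.Unique.Propositional.Properties as Unique
open import Data.Nat.Base
open import Data.Nat.Coprimality using (coprime-divisor)
open import Data.Nat.Divisibility
open import Data.Nat.DivMod using (m*n%n≡0; m*n/n≡m)
open import Data.Nat.Induction using (<-wellFounded; Acc; acc)
open import Data.Nat.ListAction using (sum)
open import Data.Nat.ListAction.Properties using (sum-++; sum-↭)
open import Data.Nat.Primality
open import Data.Nat.Properties
open import Data.Nat.Tactic.RingSolver using (solve-∀)
open import Data.Product.Base as Product using (∃-syntax; _×_; _,_; proj₂)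
open import Data.Rational.Base as ℚ using (1ℚ; toℚᵘ)
import Data.Rational.Properties as ℚ
open import Data.Rational.Unnormalised.Base as ℚᵘ using (mkℚᵘ; *≡*)
import Data.Rational.Unnormalised.Properties as ℚᵘ
open import Data.Sum.Base using (_⊎_; inj₁; inj₂)
open import Data.Unit.Base using (tt)
open import Function.Base using (_∘_)
open import Function.Bundles using (mk⇔; module Equivalence)
open import Relation.Binary.PropositionalEquality
import Relation.Binary.Reasoning.Setoid as SetoidReasoning
open import Relation.Nullary.Decidable using (yes; no; from-yes)
open import Relation.Nullary.Negation using (¬_; contradiction)

-- Divisor lists as sets without repetition.

∈-divisors⁺ : ∀ {d n} → .{{NonZero n}} → d ∣ n → d ∈ divisors n
∈-divisors⁺ {zero} {suc n} 0∣n with () ← 0∣⇒≡0 0∣n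
∈-divisors⁺ {suc d} {n@(suc _)} d∣n =
  ∈-filter⁺ (_∣? n) (∈-applyUpTo⁺ suc (∣⇒≤ d∣n)) d∣n

∈-divisors⁻ : ∀ {d} n → d ∈ divisors n → d ∣ n
∈-divisors⁻ n d∈ = proj₂ (∈-filter⁻ (_∣? n) {xs = applyUpTo suc n} d∈)

divisors-unique : ∀ n → Unique (divisors n)
divisors-unique n = Unique.filter⁺ (_∣? n)
  (Unique.applyUpTo⁺₁ suc n (λ i<j _ → <⇒≢ i<j ∘ suc-injective))

n≤σ : ∀ n → .{{NonZero n}} → n ≤ σ n
n≤σ n = ∈⇒≤sum (∈-divisors⁺ ∣-refl)

sum-map-* : ∀ c ns → sum (map (c *_) ns) ≡ c * sum ns
sum-map-* c []       = sym (*-zeroʳ c)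
sum-map-* c (n ∷ ns) = trans (cong (c * n +_) (sum-map-* c ns))
                             (sym (*-distribˡ-+ c n (sum ns)))

∣-cancel-prime-^ : ∀ {p d} → Prime p → p ∤ d → ∀ a {m} → d ∣ p ^ a * m → d ∣ m
∣-cancel-prime-^ pp p∤d zero {m} d∣ = subst (_ ∣_) (+-identityʳ m) d∣
∣-cancel-prime-^ {p} {d} pp p∤d (suc a) {m} d∣ =
  ∣-cancel-prime-^ pp p∤d a
    (coprime-divisor coprime (subst (d ∣_) (*-assoc p (p ^ a) m) d∣))
  where
  coprime : ∀ {c} → c ∣ d × c ∣ p → c ≡ 1
  coprime (c∣d , c∣p) with prime⇒irreducible pp c∣p
  ... | inj₁ c≡1  = c≡1
  ... | inj₂ refl = contradiction c∣d p∤d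

-- Divisor sums of a prime power times a cofactor.

module _ {p : ℕ} (pp : Prime p) where

  private instance _ = prime⇒nonZero pp

  -- A divisor of `p ^ suc a * m` not divisible by `p` divides `m`; any other is `p` times a divisor
  -- of `p ^ a * m`. Neither side has repetitions, so equal membership already gives a permutation.
  divisors-prime-* : ∀ a {m} → .{{NonZero m}} → p ∤ m →
    divisors (p ^ suc a * m) ↭ divisors m ++ map (p *_) (divisors (p ^ a * m))
  divisors-prime-* a {m} p∤m = ∼bag⇒↭ (unique∧set⇒bag
      (divisors-unique (p ^ suc a * m))
      (Unique.++⁺ (divisors-unique m)
        (Unique.map⁺ (λ {x} {y} → *-cancelˡ-≡ x y p) (divisors-unique n))
        λ (d∈ , d∈′) → disjoint d∈ (∈-map⁻ (p *_) d∈′))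
      (mk⇔ to from))
    where
    instance
      _ = m*n≢0 (p ^ a) m {{m^n≢0 p a}}
      _ = m*n≢0 (p ^ suc a) m {{m^n≢0 p (suc a)}}
    n = p ^ a * m
    assoc : p ^ suc a * m ≡ p * n
    assoc = *-assoc p (p ^ a) m

    disjoint : ∀ {d} → d ∈ divisors m → ¬ (∃[ e ] e ∈ divisors n × d ≡ p * e)
    disjoint d∈ (e , _ , refl) = p∤m (∣-trans (m∣m*n e) (∈-divisors⁻ m d∈))

    to : ∀ {d} → d ∈ divisors (p ^ suc a * m) → d ∈ divisors m ++ map (p *_) (divisors n)
    to {d} d∈ with p ∣? d | ∈-divisors⁻ (p ^ suc a * m) d∈
    ... | no p∤d | d∣ = ∈-++⁺ˡ (∈-divisors⁺ (∣-cancel-prime-^ pp p∤d (suc a) d∣))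
    ... | yes (divides e refl) | d∣ = ∈-++⁺ʳ (divisors m)
      (subst (_∈ map (p *_) (divisors n)) (*-comm p e)
        (∈-map⁺ (p *_) (∈-divisors⁺ (*-cancelˡ-∣ p
          (subst₂ _∣_ (*-comm e p) assoc d∣)))))

    from : ∀ {d} → d ∈ divisors m ++ map (p *_) (divisors n) → d ∈ divisors (p ^ suc a * m)
    from d∈ with ∈-++⁻ (divisors m) d∈
    ... | inj₁ d∈m = ∈-divisors⁺ (∣n⇒∣m*n (p ^ suc a) (∈-divisors⁻ m d∈m))
    ... | inj₂ d∈pn with e , e∈ , refl ← ∈-map⁻ (p *_) d∈pn =
      ∈-divisors⁺ (subst (p * e ∣_) (sym assoc) (*-monoʳ-∣ p (∈-divisors⁻ n e∈)))

  -- This recursion in the exponent takes the place of the multiplicativity of `σ` and the geometric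
  -- sum.
  σ-prime-* : ∀ a {m} → .{{NonZero m}} → p ∤ m →
    σ (p ^ suc a * m) ≡ σ m + p * σ (p ^ a * m)
  σ-prime-* a {m} p∤m = begin
    σ (p ^ suc a * m)
      ≡⟨ sum-↭ (divisors-prime-* a p∤m) ⟩
    sum (divisors m ++ map (p *_) (divisors (p ^ a * m)))
      ≡⟨ sum-++ (divisors m) _ ⟩
    σ m + sum (map (p *_) (divisors (p ^ a * m)))
      ≡⟨ cong (σ m +_) (sum-map-* p (divisors (p ^ a * m))) ⟩
    σ m + p * σ (p ^ a * m) ∎
    where open ≡-Reasoning

  -- With l = `suc k`, this is σ(p^a) / p^a < l / (l - 1) without fractions. The extra `σ m` gives
  -- equality when p = l and lets the induction on `a` close.
  σ-prime^-bound : ∀ {k} → suc k ≤ p → ∀ a {m} → .{{NonZero m}} → p ∤ m →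
    k * σ (p ^ a * m) + σ m ≤ suc k * (p ^ a * σ m)
  σ-prime^-bound {k} k<p zero {m} p∤m = ≤-reflexive (begin
    k * σ (1 * m) + σ m ≡⟨ cong (λ x → k * σ x + σ m) (*-identityˡ m) ⟩
    k * σ m + σ m       ≡⟨ +-comm (k * σ m) (σ m) ⟩
    suc k * σ m         ≡⟨ cong (suc k *_) (*-identityˡ (σ m)) ⟨
    suc k * (1 * σ m)   ∎)
    where open ≡-Reasoning
  σ-prime^-bound {k} k<p (suc a) {m} p∤m = begin
    k * σ (p ^ suc a * m) + s  ≡⟨ cong (λ x → k * x + s) (σ-prime-* a p∤m) ⟩
    k * (s + p * t) + s        ≡⟨ lemma₁ k s p t ⟩
    suc k * s + p * (k * t)    ≤⟨ +-monoˡ-≤ (p * (k * t)) (*-monoˡ-≤ s k<p) ⟩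
    p * s + p * (k * t)        ≡⟨ lemma₂ k s p t ⟩
    p * (k * t + s)            ≤⟨ *-monoʳ-≤ p (σ-prime^-bound k<p a p∤m) ⟩
    p * (suc k * (p ^ a * s))  ≡⟨ lemma₃ k s p (p ^ a) ⟩
    suc k * (p ^ suc a * s)    ∎
    where
    open ≤-Reasoning
    s = σ m
    t = σ (p ^ a * m)
    lemma₁ : ∀ k s p t → k * (s + p * t) + s ≡ suc k * s + p * (k * t)
    lemma₁ = solve-∀
    lemma₂ : ∀ k s p t → p * s + p * (k * t) ≡ p * (k * t + s)
    lemma₂ = solve-∀
    lemma₃ : ∀ k s p r → p * (suc k * (r * s)) ≡ suc k * (p * r * s)
    lemma₃ = solve-∀

  ∣σ⇒∣σ-prime^* : ∀ {d} a {m} → .{{NonZero m}} → p ∤ m → d ∣ σ m → d ∣ σ (p ^ a * m)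
  ∣σ⇒∣σ-prime^* zero {m} p∤m d∣ = subst (λ x → _ ∣ σ x) (sym (*-identityˡ m)) d∣
  ∣σ⇒∣σ-prime^* (suc a) p∤m d∣ = subst (_ ∣_) (sym (σ-prime-* a p∤m))
    (∣m∣n⇒∣m+n d∣ (∣n⇒∣m*n p (∣σ⇒∣σ-prime^* a p∤m d∣)))

  -- `σ (p ^ 2+ a * m)` is (1 + p) σ(m) + p² σ(p^a m), so evenness passes from exponent `a` to
  -- `2+ a`; at exponent 1 the sum is (1 + p) σ(m), which is even.
  odd-σ⇒even-exponent : 2 ∣ suc p → ∀ a {m} → .{{NonZero m}} → p ∤ m →
    Odd (σ (p ^ a * m)) → ∃[ i ] a ≡ i * 2
  odd-σ⇒even-exponent 2∣1+p zero p∤m odd = 0 , refl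
  odd-σ⇒even-exponent 2∣1+p 1 {m} p∤m odd = contradiction
    (subst (2 ∣_) (sym (trans (σ-prime-* 0 p∤m) (cong (λ x → σ m + p * σ x) (*-identityˡ m))))
      (∣m⇒∣m*n (σ m) 2∣1+p))
    odd
  odd-σ⇒even-exponent 2∣1+p (2+ a) {m} p∤m odd =
    Product.map suc (cong 2+) (odd-σ⇒even-exponent 2∣1+p a p∤m (odd ∘ even))
    where
    expand : ∀ s p t → s + p * (s + p * t) ≡ suc p * s + p * (p * t)
    expand = solve-∀
    even : 2 ∣ σ (p ^ a * m) → 2 ∣ σ (p ^ 2+ a * m)
    even 2∣ = subst (2 ∣_)
      (sym (trans (σ-prime-* (suc a) p∤m)
           (trans (cong (λ x → σ m + p * x) (σ-prime-* a p∤m)) (expand (σ m) p _))))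
      (∣m∣n⇒∣m+n (∣m⇒∣m*n (σ m) 2∣1+p) (∣n⇒∣m*n p (∣n⇒∣m*n p 2∣)))

  split-prime-power : ∀ n → .{{NonZero n}} → ∃[ a ] ∃[ m ] n ≡ p ^ a * m × p ∤ m
  split-prime-power n = go n (<-wellFounded n)
    where
    go : ∀ n → .{{NonZero n}} → Acc _<_ n → ∃[ a ] ∃[ m ] n ≡ p ^ a * m × p ∤ m
    go n (acc rs) with p ∣? n
    ... | no p∤n  = 0 , n , sym (*-identityˡ n) , p∤n
    ... | yes p∣n@(divides c refl)
      with a , m , c≡ , p∤m ← go c {{m*n≢0⇒m≢0 c}}
             (rs (quotient-< p∣n {{prime⇒nonTrivial pp}}))
      = suc a , m , trans (*-comm c p) (trans (cong (p *_) c≡) (sym (*-assoc p (p ^ a) m))) , p∤m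

-- Odd numbers with odd divisor sum, and roughness.

odd⇒2∣suc : ∀ {n} → Odd n → 2 ∣ suc n
odd⇒2∣suc {zero}        odd = contradiction (2 ∣0) odd
odd⇒2∣suc {1}           odd = ∣-refl
odd⇒2∣suc {suc (suc n)} odd = ∣m∣n⇒∣m+n ∣-refl (odd⇒2∣suc (odd ∘ ∣m∣n⇒∣m+n ∣-refl))

odd⇒nonZero : ∀ {n} → Odd n → NonZero n
odd⇒nonZero {zero}  odd = contradiction (2 ∣0) odd
odd⇒nonZero {suc _} odd = _

-- These are the odd squares. In this form the condition comes straight from the spoof equation and
-- passes to the cofactor of a prime power.
record OddSum (n : ℕ) : Set where
  field
    odd   : Odd n
    σ-odd : Odd (σ n)

open OddSum

record SquareSplit (p n : ℕ) : Set where
  field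
    i cofactor : ℕ
    split      : n ≡ p ^ (suc i * 2) * cofactor
    p∤cofactor : p ∤ cofactor
    oddSum     : OddSum cofactor

  cofactor∣ : cofactor ∣ n
  cofactor∣ = subst (cofactor ∣_) (sym split) (n∣m*n (p ^ (suc i * 2)))

squareSplit : ∀ {p n} → Prime p → p ∣ n → OddSum n → SquareSplit p n
squareSplit {p} {n} pp p∣n os
  with a , m , refl , p∤m ← split-prime-power pp n {{odd⇒nonZero (odd os)}}
  = finish (odd-σ⇒even-exponent pp (odd⇒2∣suc λ 2∣p → odd os (∣-trans 2∣p p∣n)) a p∤m (σ-odd os))
  where
  instance _ = m*n≢0⇒n≢0 (p ^ a) {{odd⇒nonZero (odd os)}}
  finish : ∃[ i ] a ≡ i * 2 → SquareSplit p (p ^ a * m)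
  finish (zero  , refl) = contradiction (subst (p ∣_) (*-identityˡ m) p∣n) p∤m
  finish (suc i , refl) = record
    { i = i ; cofactor = m ; split = refl ; p∤cofactor = p∤m
    ; oddSum = record
      { odd   = λ 2∣m → odd os (∣n⇒∣m*n (p ^ a) 2∣m)
      ; σ-odd = λ 2∣σm → σ-odd os (∣σ⇒∣σ-prime^* pp a p∤m 2∣σm) } }

prime-divisor : ∀ n → .{{NonTrivial n}} → ∃[ p ] Prime p × p ∣ n
prime-divisor n = go n (<-wellFounded n)
  where
  go : ∀ n → .{{NonTrivial n}} → Acc _<_ n → ∃[ p ] Prime p × p ∣ n
  go n (acc rs) with composite? n
  ... | no ¬c = n , ¬composite⇒prime ¬c , ∣-refl
  ... | yes (composite {d} d<n d∣n) with p , pp , p∣d ← go d (rs d<n) = p , pp , ∣-trans p∣d d∣n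

-- Since `k` is even, so is `2+ k`, which cannot divide an odd `n`; thus l runs over odd numbers
-- only.
rough-2+ : ∀ {k n} → 2 ∣ k → Odd n → suc k ∤ n → suc k Rough n → suc (2+ k) Rough n
rough-2+ 2∣k odd l∤n rough = ∤⇒rough-suc
  (λ 2+k∣n → odd (∣-trans (∣m∣n⇒∣m+n ∣-refl 2∣k) 2+k∣n))
  (∤⇒rough-suc l∤n rough)

-- Two Horner steps for 1 + p + p² + ...; the factor has the very shape that `branch` computes.
σ-prime²-* : ∀ {p} → Prime p → ∀ a {m g} → .{{NonZero m}} → p ∤ m →
  σ (p ^ a * m) ≡ g * σ m → σ (p ^ 2+ a * m) ≡ suc (p * suc (p * g)) * σ m
σ-prime²-* {p} pp a {m} {g} p∤m σ≡ = begin
  σ (p ^ 2+ a * m)                    ≡⟨ σ-prime-* pp (suc a) p∤m ⟩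
  σ m + p * σ (p ^ suc a * m)         ≡⟨ cong (λ x → σ m + p * x) (σ-prime-* pp a p∤m) ⟩
  σ m + p * (σ m + p * σ (p ^ a * m)) ≡⟨ cong (λ x → σ m + p * (σ m + p * x)) σ≡ ⟩
  σ m + p * (σ m + p * (g * σ m))     ≡⟨ collect p g (σ m) ⟩
  suc (p * suc (p * g)) * σ m         ∎
  where
  open ≡-Reasoning
  collect : ∀ p g s → s + p * (s + p * (g * s)) ≡ suc (p * suc (p * g)) * s
  collect = solve-∀

rough⇒1⊎squareSplit : ∀ {l n} → l Rough n → OddSum n →
  n ≡ 1 ⊎ (∃[ r ] l ≤ r × Prime r × SquareSplit r n)
rough⇒1⊎squareSplit {n = 0} _ os = contradiction (2 ∣0) (odd os)
rough⇒1⊎squareSplit {n = 1} _ os = inj₁ refl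
rough⇒1⊎squareSplit {n = n@(2+ _)} l-rough os with r , pr , r∣n ← prime-divisor n =
  inj₂ (r , rough⇒≤ {{prime⇒nonTrivial pr}} (rough∧∣⇒rough l-rough r∣n) , pr , squareSplit pr r∣n os)

square*cofactor≤ : ∀ {l r n} → l ≤ r → Prime r → (S : SquareSplit r n) →
  l * l * SquareSplit.cofactor S ≤ n
square*cofactor≤ {l} {r} l≤r pr S = subst (l * l * cofactor ≤_) (sym split)
  (*-monoˡ-≤ cofactor (*-mono-≤ l≤r (≤-trans l≤r (m≤m*n r (r ^ (i * 2))))))
  where
  open SquareSplit S
  instance
    _ = prime⇒nonZero pr
    _ = m^n≢0 r (i * 2)

-- The spoof equation with denominators cleared.

SpoofEquation : ℕ → ℕ → ℕ → Set
SpoofEquation p X Y = X * suc p ≡ 2 * p * Y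

module _ {p X Y : ℕ} (eq : SpoofEquation p X Y) where

  -- The equation reads X = 2 p Y - p X, and multiplication distributes over truncated subtraction.
  spoof⇒≡*deficiency : X ≡ p * (2 * Y ∸ X)
  spoof⇒≡*deficiency = sym (begin
    p * (2 * Y ∸ X)       ≡⟨ *-distribˡ-∸ p (2 * Y) X ⟩
    p * (2 * Y) ∸ p * X   ≡⟨ cong (_∸ p * X) (swap p Y) ⟩
    2 * p * Y ∸ p * X     ≡⟨ cong (_∸ p * X) eq ⟨
    X * suc p ∸ p * X     ≡⟨ cong (_∸ p * X) (expand p X) ⟩
    X + p * X ∸ p * X     ≡⟨ m+n∸n≡m X (p * X) ⟩
    X                     ∎)
    where
    open ≡-Reasoning
    swap : ∀ p Y → p * (2 * Y) ≡ 2 * p * Y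
    swap = solve-∀
    expand : ∀ p X → X * suc p ≡ X + p * X
    expand = solve-∀

  -- If 2 Y < X, the truncated deficiency is 0, which would force X = 0.
  spoof⇒¬abundant : .{{NonZero X}} → ¬ (2 * Y < X)
  spoof⇒¬abundant 2Y<X = ≢-nonZero⁻¹ X
    (trans spoof⇒≡*deficiency
      (trans (cong (p *_) (m≤n⇒m∸n≡0 (<⇒≤ 2Y<X))) (*-zeroʳ p)))

  -- X / Y = 2 p / (p + 1) increases with p and equals 9 / 5 at p = 9.
  spoof⇒9Y≤5X : 9 ≤ p → 9 * Y ≤ 5 * X
  spoof⇒9Y≤5X 9≤p = *-cancelʳ-≤ (9 * Y) (5 * X) (suc p) (begin
    9 * Y * suc p          ≡⟨ expand p Y ⟩
    9 * Y + 9 * (p * Y)    ≤⟨ +-monoˡ-≤ (9 * (p * Y)) (*-monoˡ-≤ Y 9≤p) ⟩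
    p * Y + 9 * (p * Y)    ≡⟨ collect p Y ⟩
    5 * (2 * p * Y)        ≡⟨ cong (5 *_) eq ⟨
    5 * (X * suc p)        ≡⟨ *-assoc 5 X (suc p) ⟨
    5 * X * suc p          ∎)
    where
    open ≤-Reasoning
    expand : ∀ p Y → 9 * Y * suc p ≡ 9 * Y + 9 * (p * Y)
    expand = solve-∀
    collect : ∀ p Y → p * Y + 9 * (p * Y) ≡ 5 * (2 * p * Y)
    collect = solve-∀

T-if : ∀ b {x y} → T (if b then x else y) → (T b × T x) ⊎ (¬ T b × T y)
T-if true  t = inj₁ (tt , t)
T-if false t = inj₂ ((λ ()) , t)

-- Read `r` as a prime power, `s` as σ(r m) and `t` as σ(m): the premise bounds s / (r t) by l / (l
-- - 1) with l = `suc k`, so a strict bound for `m` with that factor charged in advance yields one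
-- for `r * m`.
below-step : ∀ {k x y r s t m} → .{{NonZero r}} → k * s ≤ suc k * (r * t) →
  x * suc k * t < y * k * m → x * s < y * (r * m)
below-step {k} {x} {y} {r} {s} {t} {m} ks≤ xt<ym = ≰⇒> λ yrm≤xs →
  <-irrefl refl (begin-strict
    r * (y * k * m)       ≡⟨ lemma₁ k y r m ⟩
    k * (y * (r * m))     ≤⟨ *-monoʳ-≤ k yrm≤xs ⟩
    k * (x * s)           ≡⟨ lemma₂ k x s ⟩
    x * (k * s)           ≤⟨ *-monoʳ-≤ x ks≤ ⟩
    x * (suc k * (r * t)) ≡⟨ lemma₃ k x r t ⟩
    r * (x * suc k * t)   <⟨ *-monoʳ-< r xt<ym ⟩
    r * (y * k * m)       ∎)
  where
  open ≤-Reasoning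
  lemma₁ : ∀ k y r m → r * (y * k * m) ≡ k * (y * (r * m))
  lemma₁ = solve-∀
  lemma₂ : ∀ k x s → k * (x * s) ≡ x * (k * s)
  lemma₂ = solve-∀
  lemma₃ : ∀ k x r t → x * (suc k * (r * t)) ≡ r * (x * suc k * t)
  lemma₃ = solve-∀

-- From the rational equation to natural numbers.

ratio-1≡1/⇒ : ∀ a s x → .{{_ : NonZero s}} .{{_ : NonZero x}} →
  (ℤ.+ a ℚ./ s) ℚ.- 1ℚ ≡ ℤ.+ 1 ℚ./ x → s * suc x ≡ a * x
ratio-1≡1/⇒ a s@(suc s-1) x@(suc x-1) eq = begin
  s * suc x               ≡⟨ lemma s x ⟩
  (1 * 1 + 1 * x) * s     ≡⟨ crossℕ ⟨
  a * (x * 1)             ≡⟨ cong (a *_) (*-identityʳ x) ⟩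
  a * x                   ∎
  where
  open ≡-Reasoning
  lemma : ∀ s x → s * suc x ≡ (1 * 1 + 1 * x) * s
  lemma = solve-∀

  moved : ℤ.+ a ℚ./ s ≡ (ℤ.+ 1 ℚ./ x) ℚ.+ 1ℚ
  moved = begin
    ℤ.+ a ℚ./ s                              ≡⟨ ℚ.+-identityʳ _ ⟨
    (ℤ.+ a ℚ./ s) ℚ.+ ((ℚ.- 1ℚ) ℚ.+ 1ℚ)      ≡⟨ ℚ.+-assoc (ℤ.+ a ℚ./ s) (ℚ.- 1ℚ) 1ℚ ⟨
    (ℤ.+ a ℚ./ s) ℚ.- 1ℚ ℚ.+ 1ℚ              ≡⟨ cong (ℚ._+ 1ℚ) eq ⟩
    (ℤ.+ 1 ℚ./ x) ℚ.+ 1ℚ                     ∎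

  -- `ℚ` reduces fractions by gcds; in `ℚᵘ` numerators and denominators stay literal, so equality is
  -- a cross product.
  unnormalised : mkℚᵘ (ℤ.+ a) s-1 ℚᵘ.≃ mkℚᵘ (ℤ.+ 1) x-1 ℚᵘ.+ ℚᵘ.1ℚᵘ
  unnormalised = R.begin
    mkℚᵘ (ℤ.+ a) s-1                       R.≈⟨ ℚ.toℚᵘ-fromℚᵘ (mkℚᵘ (ℤ.+ a) s-1) ⟨
    toℚᵘ (ℤ.+ a ℚ./ s)                     R.≈⟨ ℚ.toℚᵘ-cong moved ⟩
    toℚᵘ ((ℤ.+ 1 ℚ./ x) ℚ.+ 1ℚ)            R.≈⟨ ℚ.toℚᵘ-homo-+ (ℤ.+ 1 ℚ./ x) 1ℚ ⟩
    toℚᵘ (ℤ.+ 1 ℚ./ x) ℚᵘ.+ ℚᵘ.1ℚᵘ         R.≈⟨ ℚᵘ.+-congˡ ℚᵘ.1ℚᵘ (ℚ.toℚᵘ-fromℚᵘ (mkℚᵘ (ℤ.+ 1) x-1)) ⟩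
    mkℚᵘ (ℤ.+ 1) x-1 ℚᵘ.+ ℚᵘ.1ℚᵘ           R.∎
    where
    module R = SetoidReasoning ℚᵘ.≃-setoid

  crossℕ : a * (x * 1) ≡ (1 * 1 + 1 * x) * s
  crossℕ with *≡* cross ← unnormalised = ℤ.+-injective (begin
    ℤ.+ (a * (x * 1))                        ≡⟨ ℤ.pos-* a (x * 1) ⟩
    ℤ.+ a ℤ.* ℤ.+ (x * 1)                    ≡⟨ cross ⟩
    (ℤ.+ (1 * 1 + 1 * x)) ℤ.* ℤ.+ s          ≡⟨ ℤ.pos-* (1 * 1 + 1 * x) s ⟨
    ℤ.+ ((1 * 1 + 1 * x) * s)                ∎)

-- Parity of σ(q) and the lower bound for p.

odd*odd : ∀ {m n} → Odd m → Odd n → Odd (m * n)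
odd*odd {m} {n} odd-m odd-n 2∣mn with euclidsLemma m n prime[2] 2∣mn
... | inj₁ 2∣m = odd-m 2∣m
... | inj₂ 2∣n = odd-n 2∣n

-- If X were even, then, p + 1 being even too, 4 would divide X (p + 1) = 2 p Y, and 2 would divide
-- the odd number p Y.
spoof⇒odd : ∀ {p X Y} → Odd p → Odd Y → SpoofEquation p X Y → Odd X
spoof⇒odd {p} {X} {Y} odd-p odd-Y eq 2∣X =
  odd*odd odd-p odd-Y (*-cancelˡ-∣ 2 (subst (2 * 2 ∣_) (trans eq (*-assoc 2 p Y))
    (∣-trans (*-monoʳ-∣ 2 (odd⇒2∣suc odd-p)) (*-monoˡ-∣ (suc p) 2∣X))))

odd-nonprime⇒9≤ : ∀ {n} → n > 1 → Odd n → ¬ Prime n → 9 ≤ n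
odd-nonprime⇒9≤ {n} n>1 odd ¬pn = ≮⇒≥ (λ n<9 → small n n>1 odd ¬pn n<9)
  where
  small : ∀ n → n > 1 → Odd n → ¬ Prime n → ¬ (n < 9)
  small 0 ()
  small 1 (s<s ())
  small 2 _ odd _ _ = odd (divides-refl 1)
  small 3 _ _ ¬p _ = ¬p (from-yes (prime? 3))
  small 4 _ odd _ _ = odd (divides-refl 2)
  small 5 _ _ ¬p _ = ¬p (from-yes (prime? 5))
  small 6 _ odd _ _ = odd (divides-refl 3)
  small 7 _ _ ¬p _ = ¬p (from-yes (prime? 7))
  small 8 _ odd _ _ = odd (divides-refl 4)
  small n@(suc (suc (suc (suc (suc (suc (suc (suc (suc _))))))))) _ _ _ n<9 = <⇒≱ n<9 (m≤m+n 9 _)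

-- The bounded depth-first search.

module Search (L D : ℕ) where

  -- Throughout, l = 1 + k is a lower bound for the prime factors still allowed and f is fuel.
  -- Writing 1 + k rather than suc k lets evaluation stay within built-in arithmetic on literals.

  -- Bounds x σ(n) < y n for l-rough n ≤ L / M with odd σ(n): each further prime square
  -- divides the room left for n by at least l² and costs at most a factor l / (l − 1).
  below : ℕ → ℕ → ℕ → ℕ → ℕ → Bool
  below zero    M x y k = false
  below (suc f) M x y k =
    if L <ᵇ M * ((1 + k) * (1 + k)) then x <ᵇ y
    else below f (M * ((1 + k) * (1 + k))) (x * (1 + k)) (y * k) k

  -- With d = 2 K − A, the only candidate for p is A / d.
  leaf : ℕ → ℕ → ℕ → Bool
  leaf A K zero      = false
  leaf A K d@(suc _) = not (A % d ≡ᵇ 0) ∨ (K * (A / d) ≡ᵇ D)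

  -- A is σ(K); branch runs through the even powers of l, with g the divisor sum of the current
  -- one.  When l is composite the branch is never needed, so no primality test is performed.
  search : ℕ → ℕ → ℕ → ℕ → Bool
  branch : ℕ → ℕ → ℕ → ℕ → ℕ → Bool

  search zero    A K k = false
  search (suc f) A K k =
    if 2 * K <ᵇ A then true
    else if L <ᵇ K * ((1 + k) * (1 + k)) then leaf A K (2 * K ∸ A)
    else if below f K (5 * A) (9 * K) k then true
    else (branch f A (K * ((1 + k) * (1 + k))) k (1 + (1 + k) * (1 + (1 + k) * 1))
          ∧ search f A K (2 + k))

  branch zero    A K k g = false
  branch (suc f) A K k g =
    if L <ᵇ K then true
    else (search f (A * g) K (2 + k)
          ∧ branch f A (K * ((1 + k) * (1 + k))) k (1 + (1 + k) * (1 + (1 + k) * g)))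

  -- Soundness of the search.

  L<M*l²⇒≡1 : ∀ {l M n} → L < M * (l * l) → l Rough n → OddSum n → M * n ≤ L → n ≡ 1
  L<M*l²⇒≡1 {l} {M} {n} L< rough os Mn≤L with rough⇒1⊎squareSplit rough os
  ... | inj₁ n≡1 = n≡1
  -- A prime factor of `n` is at least l and occurs squared, so `M * n` would exceed `L`.
  ... | inj₂ (r , l≤r , pr , S) = contradiction (≤-trans (*-monoʳ-≤ M l²≤n) Mn≤L) (<⇒≱ L<)
    where
    open SquareSplit S
    l²≤n = ≤-trans (m≤m*n (l * l) cofactor {{odd⇒nonZero (odd oddSum)}}) (square*cofactor≤ l≤r pr S)

  below-sound : ∀ f {M x y k n} → T (below f M x y k) →
    suc k Rough n → OddSum n → M * n ≤ L → x * σ n < y * n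
  below-sound zero () _ _ _
  below-sound (suc f) {M} {x} {y} {k} {n} ok rough os Mn≤L with T-if (L <ᵇ M * (suc k * suc k)) ok
  ... | inj₁ (tL< , tx<y) with refl ← L<M*l²⇒≡1 {M = M} (<ᵇ⇒< L _ tL<) rough os Mn≤L
    = *-monoˡ-< 1 (<ᵇ⇒< x y tx<y)
  ... | inj₂ (¬L< , ok′) with rough⇒1⊎squareSplit rough os
  -- For n = 1 the factor l / (l - 1) is charged without any prime; `below-step` at the trivial
  -- power 1 absorbs it.
  ...   | inj₁ refl = below-step {k} {x} {y} {r = 1} {s = 1} {t = 1} {m = 1} (*-monoˡ-≤ 1 (n≤1+n k))
            (below-sound f {M = M * (suc k * suc k)} ok′ rough os
              (subst (_≤ L) (sym (*-identityʳ (M * (suc k * suc k)))) (≮⇒≥ (¬L< ∘ <⇒<ᵇ))))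
  ...   | inj₂ (r , l≤r , pr , record { i = i ; cofactor = m ; split = refl ; p∤cofactor = r∤m ; oddSum = osm })
    = below-step {k} {x} {y} {r ^ a} {m = m}
        (≤-trans (m≤m+n _ (σ m)) (σ-prime^-bound pr l≤r a r∤m))
        (below-sound f ok′ (rough∧∣⇒rough rough (n∣m*n (r ^ a))) osm
          (≤-trans (≤-reflexive (*-assoc M (suc k * suc k) m))
            (≤-trans (*-monoʳ-≤ M (square*cofactor≤ {n = r ^ a * m} l≤r pr
               (record { i = i ; split = refl ; p∤cofactor = r∤m ; oddSum = osm }))) Mn≤L)))
    where
    a = suc i * 2
    instance
      _ = prime⇒nonZero pr
      _ = m^n≢0 r a
      _ = odd⇒nonZero (odd osm)

  -- With A = p d and d nonzero, the remainder vanishes and the quotient is p, which leaves only the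
  -- comparison with `D`. At d = 0 `leaf` is `false`.
  leaf-sound : ∀ {A K p} d → T (leaf A K d) → A ≡ p * d → K * p ≡ D
  leaf-sound {K = K} {p} d@(suc _) ok refl with Equivalence.to T-∨ ok
  ... | inj₁ d∤ = contradiction d∤ (subst (λ x → ¬ T (not (x ≡ᵇ 0))) (sym (m*n%n≡0 p d)) λ ())
  ... | inj₂ eq = trans (cong (K *_) (sym (m*n/n≡m p d))) (≡ᵇ⇒≡ _ D eq)

  module _ {p : ℕ} (9≤p : 9 ≤ p) where

    -- The invariant is the equation itself, with X = `A * σ n` and Y = `K * n`: K is the explored
    -- part of q and n the rest.
    search-sound : ∀ f {A K k n} → .{{NonZero k}} → T (search f A K k) → 2 ∣ k → suc k Rough n → OddSum n →
      K * n ≤ L → SpoofEquation p (A * σ n) (K * n) → K * n * p ≡ D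

    -- The current power of l is l ^ a, and n contains l to the power i * 2 + a.
    branch-sound : ∀ f {A K K₀ k g} a → T (branch f A K k g) → 2 ∣ k → Prime (suc k) →
      K ≡ K₀ * suc k ^ a →
      (∀ {m} → .{{NonZero m}} → suc k ∤ m → σ (suc k ^ a * m) ≡ g * σ m) →
      ∀ i {m n} → n ≡ suc k ^ (i * 2 + a) * m → suc k ∤ m → suc (2+ k) Rough m → OddSum m →
      K₀ * n ≤ L → SpoofEquation p (A * σ n) (K₀ * n) → K₀ * n * p ≡ D

    search-sound zero ()
    search-sound (suc f) {A} {K} {k} {n} ok 2∣k rough os Kn≤L spoof
      with T-if (2 * K <ᵇ A) ok
    -- As σ(n) ≥ n, an abundant K makes A σ(n) exceed 2 K n.
    ... | inj₁ (t2K<A , _) = contradiction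
            (<-≤-trans (subst (_< A * n) (*-assoc 2 K n) (*-monoˡ-< n 2K<A)) (*-monoʳ-≤ A (n≤σ n)))
            (spoof⇒¬abundant spoof)
      where
      2K<A = <ᵇ⇒< (2 * K) A t2K<A
      instance
        _ = odd⇒nonZero (odd os)
        _ = m*n≢0 A (σ n) {{>-nonZero (≤-<-trans z≤n 2K<A)}} {{σ-nonZero n}}
    ... | inj₂ (_ , ok₁) with T-if (L <ᵇ K * (suc k * suc k)) ok₁
    ...   | inj₁ (tL< , ok₂) with refl ← L<M*l²⇒≡1 {M = K} (<ᵇ⇒< L _ tL<) rough os Kn≤L
      = trans (cong (_* p) (*-identityʳ K)) (leaf-sound (2 * K ∸ A) ok₂
          (subst₂ (λ X Y → X ≡ p * (2 * Y ∸ X)) (*-identityʳ A) (*-identityʳ K) (spoof⇒≡*deficiency spoof)))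
    ...   | inj₂ (_ , ok₂) with T-if (below f K (5 * A) (9 * K) k) ok₂
    ...     | inj₁ (tbelow , _) = contradiction
                (subst₂ _≤_ (sym (*-assoc 9 K n)) (sym (*-assoc 5 A (σ n))) (spoof⇒9Y≤5X {X = A * σ n} spoof 9≤p))
                (<⇒≱ (below-sound f {M = K} tbelow rough os Kn≤L))
    ...     | inj₂ (_ , ok₃) with Equivalence.to T-∧ ok₃ | suc k ∣? n
    ...       | _ , ok₄ | no l∤n = search-sound f ok₄ (∣m∣n⇒∣m+n ∣-refl 2∣k)
                    (rough-2+ 2∣k (odd os) l∤n rough) os Kn≤L spoof
    ...       | ok₄ , _ | yes l∣n =
      -- The first even power is l², with `g` = 1 + l + l²; `i` counts the further squares of l in
      -- `n`.
      branch-sound f {K₀ = K} {g = suc (l * suc (l * 1))} 2 ok₄ 2∣k pl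
        (cong (λ x → K * (l * x)) (sym (*-identityʳ l)))
        (λ {m} l∤m → σ-prime²-* pl 0 {g = 1} l∤m
          (trans (cong σ (*-identityˡ m)) (sym (*-identityˡ (σ m)))))
        i (trans split (cong (λ e → l ^ e * cofactor) (+-comm 2 (i * 2)))) p∤cofactor
        (rough-2+ 2∣k (odd oddSum) p∤cofactor (rough∧∣⇒rough rough cofactor∣)) oddSum
        Kn≤L spoof
      where
      l = suc k
      pl : Prime l
      -- An l-rough `n` has no divisor strictly between 1 and l, so l dividing `n` is prime.
      pl = rough∧∣⇒prime {{n>1⇒nonTrivial (s<s (>-nonZero⁻¹ k))}} rough l∣n
      open SquareSplit (squareSplit pl l∣n os)

    branch-sound zero _ ()
    branch-sound (suc f) {A} {K} {K₀} {k} {g} a ok 2∣k pl K≡ σ≡ i {m} {n} n≡ l∤m rough os K₀n≤L spoof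
      with T-if (L <ᵇ K) ok
    -- `n` is a multiple of l^a, so K₀ n is at least K.
    ... | inj₁ (tL<K , _) = contradiction
            (≤-trans (subst₂ (λ x y → x ≤ K₀ * y) (sym K≡) (sym n≡) (*-monoʳ-≤ K₀ l^a≤)) K₀n≤L)
            (<⇒≱ (<ᵇ⇒< L K tL<K))
      where
      l^a≤ : suc k ^ a ≤ suc k ^ (i * 2 + a) * m
      l^a≤ = ≤-trans (^-monoʳ-≤ (suc k) (m≤n+m a (i * 2)))
                     (m≤m*n _ m {{odd⇒nonZero (odd os)}})
    ... | inj₂ (_ , ok′) with Equivalence.to T-∧ ok′ | i | n≡
    -- Here l^a is the exact power of l in `n`: it moves into K and the search resumes at the next
    -- odd l.
    ...   | ok₁ , _ | zero | n≡ = subst (λ x → x * p ≡ D) (sym K₀n≡Km)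
            (search-sound f ok₁ (∣m∣n⇒∣m+n ∣-refl 2∣k) rough os (subst (_≤ L) K₀n≡Km K₀n≤L)
              (subst₂ (SpoofEquation p) Aσn≡ K₀n≡Km spoof))
      where
      K₀n≡Km : K₀ * n ≡ K * m
      K₀n≡Km = trans (cong (K₀ *_) n≡) (trans (sym (*-assoc K₀ (suc k ^ a) m)) (cong (_* m) (sym K≡)))
      Aσn≡ : A * σ n ≡ A * g * σ m
      Aσn≡ = trans (cong (A *_) (trans (cong σ n≡) (σ≡ {{odd⇒nonZero (odd os)}} l∤m)))
                   (sym (*-assoc A g (σ m)))
    -- Here `n` contains a higher power: `K₀` and `n` stay fixed while `a` grows by two.
    ...   | _ , ok₂ | suc i | n≡ = branch-sound f {K₀ = K₀} (2+ a) ok₂ 2∣k pl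
            (trans (cong (_* (suc k * suc k)) K≡) (regroup K₀ (suc k) (suc k ^ a)))
            (λ l∤m → σ-prime²-* pl a {g = g} l∤m (σ≡ l∤m))
            i (trans n≡ (cong (λ e → suc k ^ e * m) (shift (i * 2) a))) l∤m rough os K₀n≤L spoof
      where
      regroup : ∀ x y z → x * z * (y * y) ≡ x * (y * (y * z))
      regroup = solve-∀
      shift : ∀ e a → 2+ (e + a) ≡ e + 2+ a
      shift = solve-∀

  -- Running the search from its root.

  spoof≡ : ∀ f → search f 1 1 2 ≡ true → ∀ {d q p} → IsOddSpoof d q p → q ≤ L → d ≡ D
  spoof≡ f ok {d} {q} {p} spoof q≤L = begin
    d         ≡⟨ D≡n*x ⟩
    q * p     ≡⟨ cong (_* p) (*-identityˡ q) ⟨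
    1 * q * p ≡⟨ search-sound (odd-nonprime⇒9≤ x>1 x-odd x-notPrime) f (Equivalence.from T-≡ ok)
                   -- An odd q is 3-rough, so the search may start at l = 3 with K = A = 1.
                   ∣-refl (∤⇒rough-suc n-odd 2-rough) oddSum (≤-trans (≤-reflexive (*-identityˡ q)) q≤L)
                   (subst₂ (SpoofEquation p) (sym (*-identityˡ (σ q))) (sym (*-identityˡ q)) eq) ⟩
    D         ∎
    where
    open ≡-Reasoning
    open IsOddSpoof spoof
    open CorrespondsTo corresponds
    swap : ∀ q p → 2 * q * p ≡ 2 * p * q
    swap = solve-∀
    eq : SpoofEquation p (σ q) q
    eq = trans (ratio-1≡1/⇒ (2 * q) (σ q) p {{σ-nonZero q}} equation) (swap q p)
    oddSum : OddSum q
    oddSum = record { odd = n-odd ; σ-odd = spoof⇒odd x-odd n-odd eq }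

-- Holds by evaluation. The fuel 1000000 bounds the recursion depth, not the number of nodes;
-- running out yields `false`, so `true` certifies a complete search.
search-succeeds : Search.search (10 ^ 12) 198585576189 1000000 1 1 2 ≡ true
search-succeeds = refl

theorem1 : (D q p : ℕ) → IsOddSpoof D q p → D ≢ 198585576189 → q > 10 ^ 12
theorem1 D q p spoof D≢ = ≰⇒> (D≢ ∘ Search.spoof≡ (10 ^ 12) 198585576189 1000000 search-succeeds spoof)
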